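{- Let $G$ be a digraph and let $\mathcal{T}$ be a set of pairwise distinguishable tangles in $G$. Then $\mathcal{T}$ has a tree-labelling, i.e. there is a triple $(L,\beta,\gamma)$ where $L$ is a tree, $\beta:V(L)\to\mathcal{T}$ and $\gamma:E(L)\to\mathcal{S}(G)$ are functions such that \begin{enumerate} \item $\beta$ is a bijection between $V(L)$ and $\mathcal{T}$; \item if $t\neq t'\in V(L)$ and $P$ is the unique path in $L$ between $t$ and $t'$, then for every edge $e\in E(P)$ with $|\gamma(e)|=\min\{|\gamma(e')| : e'\in E(P)\}$ the separation $\gamma(e)$ is a minimum order distinguisher between $\beta(t)$ and $\beta(t')$; \item for every edge $e=\{s,s'\}\in E(L)$ there are a node $t$ in the component of $L-e$ containing $s$ and a node $t'$ in the component of $L-e$ containing $s'$ such that $\gamma(e)$ is a minimum order distinguisher of $\beta(t)$ and $\beta(t')$. \end{enumerate}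
   Context: All graphs are finite digraphs. A directed separation of a digraph $G$ is a pair $(A,B)$ of subgraphs of $G$ with $V(A)\cup V(B)=V(G)$ such that either no edge of $G$ has its tail in $V(A)\setminus V(B)$ and its head in $V(B)\setminus V(A)$, or no edge of $G$ has its tail in $V(B)\setminus V(A)$ and its head in $V(A)\setminus V(B)$. Its order $|(A,B)|$ is $|V(A)\cap V(B)|$. $\mathcal{S}(G)$ denotes the set of all directed separations of $G$. A tangle of order $k$ in $G$ is a set $\mathcal{T}$ of directed separations of $G$, each of order $<k$, such that (i) for every directed separation $(A,B)$ of $G$ of order $<k$, $(A,B)\in\mathcal{T}$ or $(B,A)\in\mathcal{T}$, and (ii) for all (not necessarily distinct) $(A_1,B_1),(A_2,B_2),(A_3,B_3)\in\mathcal{T}$ we have $V(A_1)\cup V(A_2)\cup V(A_3)\neq V(G)$. A separation $(A,B)$ distinguishes tangles $T,T'$ (is a $T$–$T'$-distinguisher) if one of $T,T'$ contains $(A,B)$ and the other contains $(B,A)$. Two tangles are distinguishable if some separation distinguishes them. A minimum order distinguisher of $T,T'$ is a $T$–$T'$-distinguisher of smallest order among all $T$–$T'$-distinguishers. -}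

module Defs where

open import Data.Nat using (ℕ; _<_; _≤_)
open import Data.Fin using (Fin)
open import Data.Fin.Subset using (Subset; _∈_; _∉_; _∩_; ∣_∣)
open import Data.List using (List; []; _∷_)
open import Data.List.Relation.Unary.Unique.Propositional using (Unique)
open import Data.List.Membership.Propositional renaming (_∈_ to _∈ₗ_; _∉_ to _∉ₗ_)
open import Data.Product using (Σ; Σ-syntax; ∃; ∃-syntax; _×_; _,_)
open import Data.Sum using (_⊎_)
open import Data.Empty using (⊥)
open import Relation.Nullary using (¬_)
open import Relation.Binary.PropositionalEquality using (_≡_; _≢_)
open import Function.Definitions using (Bijective)

record Digraph : Set where
  field
    n    : ℕ
    m    : ℕ
    tail : Fin m → Fin n
    head : Fin m → Fin n
open Digraph public

record SubgraphData (G : Digraph) : Set where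
  constructor sub
  field
    V : Subset (n G)
    E : Subset (m G)
open SubgraphData public

IsSubgraph : (G : Digraph) → SubgraphData G → Set
IsSubgraph G A = ∀ e → e ∈ E A → (tail G e ∈ V A) × (head G e ∈ V A)

record Pair (G : Digraph) : Set where
  constructor _,ˢ_
  field
    fst : SubgraphData G
    snd : SubgraphData G
open Pair public

swap : {G : Digraph} → Pair G → Pair G
swap (A ,ˢ B) = B ,ˢ A

NoEdgeFromTo : (G : Digraph) → SubgraphData G → SubgraphData G → Set
NoEdgeFromTo G A B =
  ∀ e → tail G e ∈ V A → tail G e ∉ V B → head G e ∈ V B → head G e ∉ V A → ⊥

IsSep : (G : Digraph) → Pair G → Set
IsSep G (A ,ˢ B) =
  IsSubgraph G A × IsSubgraph G B ×
  (∀ v → v ∈ V A ⊎ v ∈ V B) ×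
  (NoEdgeFromTo G A B ⊎ NoEdgeFromTo G B A)

order : {G : Digraph} → Pair G → ℕ
order (A ,ˢ B) = ∣ V A ∩ V B ∣

SepSet : Digraph → Set₁
SepSet G = Pair G → Set

IsTangle : (G : Digraph) → ℕ → SepSet G → Set
IsTangle G k T =
  (∀ s → T s → IsSep G s × order s < k) ×
  (∀ s → IsSep G s → order s < k → T s ⊎ T (swap s)) ×
  (∀ s₁ s₂ s₃ → T s₁ → T s₂ → T s₃ →
     ¬ (∀ v → v ∈ V (fst s₁) ⊎ v ∈ V (fst s₂) ⊎ v ∈ V (fst s₃)))

IsTangleOfSomeOrder : (G : Digraph) → SepSet G → Set
IsTangleOfSomeOrder G T = ∃[ k ] IsTangle G k T

Distinguishes : {G : Digraph} → Pair G → SepSet G → SepSet G → Set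
Distinguishes s T T' = (T s × T' (swap s)) ⊎ (T' s × T (swap s))

Distinguishable : {G : Digraph} → SepSet G → SepSet G → Set
Distinguishable T T' = ∃[ s ] Distinguishes s T T'

MinOrderDistinguisher : {G : Digraph} → Pair G → SepSet G → SepSet G → Set
MinOrderDistinguisher s T T' =
  Distinguishes s T T' × (∀ s' → Distinguishes s' T T' → order s ≤ order s')

record Graph : Set where
  field
    q    : ℕ
    r    : ℕ
    end₁ : Fin r → Fin q
    end₂ : Fin r → Fin q
open Graph public

Joins : (L : Graph) → Fin (r L) → Fin (q L) → Fin (q L) → Set
Joins L e x y = (end₁ L e ≡ x × end₂ L e ≡ y) ⊎ (end₁ L e ≡ y × end₂ L e ≡ x)

data Walk (L : Graph) : Fin (q L) → Fin (q L) → Set where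
  []   : ∀ {x} → Walk L x x
  step : ∀ {x y z} (e : Fin (r L)) → Joins L e x y → Walk L y z → Walk L x z

verts : {L : Graph} {x y : Fin (q L)} → Walk L x y → List (Fin (q L))
verts {x = x} []           = x ∷ []
verts {x = x} (step e _ w) = x ∷ verts w

edges : {L : Graph} {x y : Fin (q L)} → Walk L x y → List (Fin (r L))
edges []           = []
edges (step e _ w) = e ∷ edges w

IsPath : {L : Graph} {x y : Fin (q L)} → Walk L x y → Set
IsPath w = Unique (verts w)

Connected : Graph → Set
Connected L = ∀ x y → Walk L x y

-- a cycle: an edge e joining x and y together with a path from y back to x
-- not using e (this covers loops and parallel edges as cycles)
HasCycle : Graph → Set
HasCycle L =
  Σ[ e ∈ Fin (r L) ] Σ[ x ∈ Fin (q L) ] Σ[ y ∈ Fin (q L) ]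
  Σ[ _ ∈ Joins L e x y ] Σ[ w ∈ Walk L y x ] (IsPath w × e ∉ₗ edges w)

IsTree : Graph → Set
IsTree L = Connected L × ¬ HasCycle L

InComponentWithout : (L : Graph) → Fin (r L) → Fin (q L) → Fin (q L) → Set
InComponentWithout L e x y = Σ[ w ∈ Walk L x y ] e ∉ₗ edges w

IsTreeLabelling : (G : Digraph) {p : ℕ} (𝒯 : Fin p → SepSet G)
                  (L : Graph) → (Fin (q L) → Fin p) → (Fin (r L) → Pair G) → Set
IsTreeLabelling G 𝒯 L β γ =
  IsTree L ×
  (∀ e → IsSep G (γ e)) ×
  Bijective _≡_ _≡_ β ×
  (∀ t t' → t ≢ t' → (P : Walk L t t') → IsPath P →
     ∀ e → e ∈ₗ edges P →
       (∀ e' → e' ∈ₗ edges P → order (γ e) ≤ order (γ e')) →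
       MinOrderDistinguisher (γ e) (𝒯 (β t)) (𝒯 (β t'))) ×
  (∀ e → Σ[ t ∈ Fin (q L) ] Σ[ t' ∈ Fin (q L) ]
     InComponentWithout L e (end₁ L e) t ×
     InComponentWithout L e (end₂ L e) t' ×
     MinOrderDistinguisher (γ e) (𝒯 (β t)) (𝒯 (β t')))

HasTreeLabelling : (G : Digraph) {p : ℕ} (𝒯 : Fin p → SepSet G) → Set
HasTreeLabelling G 𝒯 =
  Σ[ L ∈ Graph ] Σ[ β ∈ (Fin (q L) → _) ] Σ[ γ ∈ (Fin (r L) → Pair G) ]
    IsTreeLabelling G 𝒯 L β γ

{-# OPTIONS --safe #-}
module Submission where

-- The labelling is a Gomory–Hu type tree on the tangles themselves. Each edge carries a
-- separation together with a bipartition of all tangles; the bipartitions are pairwise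
-- noncrossing, each is the only one separating some pair of tangles, and together they
-- separate all pairs, so joining for each bipartition its private pair gives a tree.
-- They are found in order of increasing order k of the separations. When x and y are not yet
-- separated and have a minimum order distinguisher s of order k, only the tangles that no
-- separation of order < k distinguishes from x matter. Every directed separation or its swap
-- has no edge from its first to its second side, so s and an earlier separation c of order k can
-- be oriented alike; then their join and meet are directed separations, and by
-- submodularity s can be replaced by a corner with c. This uses only one of the two pairs
-- of opposite corners, the other one not being available for digraphs.

open import Defs
open import Data.Nat using (ℕ; zero; suc; _+_; _≤_; _<_; z≤n; s≤s⁻¹; _≤?_; _<?_)
import Data.Nat.Properties as ℕ
open import Algebra.Properties.CommutativeSemigroup ℕ.+-commutativeSemigroup using (interchange)
open import Data.Bool using (Bool; true; false; _∧_; _∨_; _≟_)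
open import Data.Bool.Properties using (¬-not)
open import Data.Fin using (Fin; zero; suc; combine; remQuot)
import Data.Fin.Properties as Fin
open import Data.Fin.Subset using (Subset; _∈_; _∉_; _∩_; _∪_; ∣_∣; ⊥)
open import Data.Fin.Subset.Properties
  using (_∈?_; ∉⊥; ∩-comm; ∣p∣≤n; x∈p∩q⁺; x∈p∩q⁻; x∈p∪q⁺; x∈p∪q⁻; anySubset?)
open import Data.Vec using ([]; _∷_)
open import Data.List using (List; []; _∷_; allFin)
open import Data.List.Membership.Propositional renaming (_∈_ to _∈ₗ_; _∉_ to _∉ₗ_)
open import Data.List.Membership.Propositional.Properties using (∈-allFin)
open import Data.List.Relation.Unary.Any as Any using (here; there)
open import Data.List.Relation.Unary.All using (lookup)
open import Data.List.Relation.Unary.AllPairs using (_∷_)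
open import Data.Product using (Σ-syntax; ∃; ∃₂; _×_; _,_; proj₁; proj₂; uncurry)
import Data.Product as Product
open import Data.Sum using (_⊎_; inj₁; inj₂; [_,_]′)
import Data.Sum as Sum
open import Data.Empty using (⊥-elim)
open import Function using (_∘_; id; flip; mk⇔)
open import Relation.Nullary using (¬_; Dec; yes; no; contradiction; does)
open import Relation.Nullary.Decidable using (map′; does-⇔; dec-true; dec-false; _×-dec_; _⊎-dec_; _→-dec_; ¬?; decidable-stable)
open import Relation.Binary.PropositionalEquality
  using (_≡_; _≢_; refl; sym; trans; cong; cong₂; subst; ≢-sym)

-- Bipartitions and noncrossing.

≢-≢⇒≡ : {a b c : Bool} → a ≢ c → b ≢ c → a ≡ b
≢-≢⇒≡ a≢c b≢c = trans (¬-not a≢c) (sym (¬-not b≢c))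

OnlySeparator : ∀ {p r} → (Fin r → Fin p → Bool) → Fin r → Fin p → Fin p → Set
OnlySeparator side e x y = side e x ≢ side e y × (∀ f → f ≢ e → side f x ≡ side f y)

OnlySeparator-sym : ∀ {p r} (side : Fin r → Fin p → Bool) {e x y} →
  OnlySeparator side e x y → OnlySeparator side e y x
OnlySeparator-sym side (e-sep , f-same) = ≢-sym e-sep , λ f f≢e → sym (f-same f f≢e)

-- Crossing means that `a`, `b`, `c`, `d` inhabit all four corners. Naming corners by equalities
-- makes this invariant under complementing `σ` or `τ`.
NonCrossing : ∀ {p} → (Fin p → Bool) → (Fin p → Bool) → Set
NonCrossing σ τ = ∀ {a b c d} →
  σ a ≡ σ b → σ c ≡ σ d → σ a ≢ σ c →
  τ a ≡ τ c → τ b ≡ τ d → ¬ (τ a ≢ τ b)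

NonCrossing-sym : ∀ {p} {σ τ : Fin p → Bool} → NonCrossing σ τ → NonCrossing τ σ
NonCrossing-sym στ ab cd ac ac′ bd′ ab′ = στ ac′ bd′ ab′ ab cd ac

NonCrossing-refl : ∀ {p} (σ : Fin p → Bool) → NonCrossing σ σ
NonCrossing-refl σ ab cd ac ac′ bd ab′ = ab′ ab

-- Walks in a graph whose edges carry bipartitions.

module EdgeSides (L : Graph) (side : Fin (r L) → Fin (q L) → Bool)
  (only : ∀ e → OnlySeparator side e (end₁ L e) (end₂ L e)) where

  joins-sep : ∀ {e x y} → Joins L e x y → side e x ≢ side e y
  joins-sep (inj₁ (refl , refl)) = proj₁ (only _)
  joins-sep (inj₂ (refl , refl)) = ≢-sym (proj₁ (only _))

  joins-same : ∀ {e f x y} → f ≢ e → Joins L e x y → side f x ≡ side f y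
  joins-same f≢e (inj₁ (refl , refl)) = proj₂ (only _) _ f≢e
  joins-same f≢e (inj₂ (refl , refl)) = sym (proj₂ (only _) _ f≢e)

  avoiding⇒same : ∀ {e x y} (w : Walk L x y) → e ∉ₗ edges w → side e x ≡ side e y
  avoiding⇒same []           e∉ = refl
  avoiding⇒same (step f j w) e∉ =
    trans (joins-same (e∉ ∘ here) j) (avoiding⇒same w (e∉ ∘ there))

  sep⇒∈ : ∀ {e x y} (w : Walk L x y) → side e x ≢ side e y → e ∈ₗ edges w
  sep⇒∈ []           ne = contradiction refl ne
  sep⇒∈ {e} (step f j w) ne with e Fin.≟ f
  ... | yes e≡f = here e≡f
  ... | no  e≢f = there (sep⇒∈ w (ne ∘ trans (joins-same e≢f j)))

  start∈verts : ∀ {x y} (w : Walk L x y) → x ∈ₗ verts w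
  start∈verts []           = here refl
  start∈verts (step _ _ _) = here refl

  ends∈verts : ∀ {e x y u v} (w : Walk L x y) → e ∈ₗ edges w → Joins L e u v → u ∈ₗ verts w
  ends∈verts (step e (inj₁ (refl , _)) w) (here refl) (inj₁ (refl , _)) = here refl
  ends∈verts (step e (inj₁ (_ , refl)) w) (here refl) (inj₂ (_ , refl)) = there (start∈verts w)
  ends∈verts (step e (inj₂ (refl , _)) w) (here refl) (inj₁ (refl , _)) = there (start∈verts w)
  ends∈verts (step e (inj₂ (_ , refl)) w) (here refl) (inj₂ (_ , refl)) = here refl
  ends∈verts (step e _ w) (there e∈) j = there (ends∈verts w e∈ j)

  -- A path uses `e` only once, since a second use would revisit an end of `e`. With `sep⇒∈`, the
  -- edges of a path are exactly the separators of its ends.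
  path∋⇒sep : ∀ {e x y} (w : Walk L x y) → IsPath w → e ∈ₗ edges w → side e x ≢ side e y
  path∋⇒sep (step e j w) (x∉ ∷ _) (here refl) eq =
    joins-sep j (trans eq (sym (avoiding⇒same w λ e∈ → lookup x∉ (ends∈verts w e∈ j) refl)))
  path∋⇒sep {e} (step f j w) (x∉ ∷ u) (there e∈) with e Fin.≟ f
  ... | yes refl = ⊥-elim (lookup x∉ (ends∈verts w e∈ j) refl)
  ... | no  e≢f  = λ eq → path∋⇒sep w u e∈ (trans (sym (joins-same e≢f j)) eq)

  acyclic : ¬ HasCycle L
  acyclic (e , x , y , j , w , _ , e∉) = joins-sep j (sym (avoiding⇒same w e∉))

_++ʷ_ : ∀ {L x y z} → Walk L x y → Walk L y z → Walk L x z
[]         ++ʷ w = w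
step e j v ++ʷ w = step e j (v ++ʷ w)

-- The tree of a noncrossing family of bipartitions.

module CutTree {p r} (side : Fin r → Fin p → Bool) (a b : Fin r → Fin p)
  (only : ∀ e → OnlySeparator side e (a e) (b e))
  (noncrossing : ∀ e f → NonCrossing (side e) (side f))
  (separating : ∀ x y → (∀ e → side e x ≡ side e y) → x ≡ y) where

  tree : Graph
  tree = record { q = p ; r = r ; end₁ = a ; end₂ = b }

  open EdgeSides tree side only public

  -- If e separates x from y and joins c, on the side of x, to d, then by noncrossing
  -- every separator of x from c and of d from y is a separator of x from y other than e.
  walkWithin : (es : List (Fin r)) (x y : Fin p) →
    (∀ e → side e x ≢ side e y → e ∈ₗ es) → Walk tree x y
  walkWithin [] x y bound
    with refl ← separating x y (λ e → decidable-stable (_ ≟ _) (λ ne → contradiction (bound e ne) λ ())) = []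
  walkWithin (e ∷ es) x y bound with side e x ≟ side e y
  ... | yes same = walkWithin es x y λ f ne → Any.tail (λ { refl → ne same }) (bound f ne)
  ... | no e-sep = via (side e x ≟ side e (a e))
    where
    across : ∀ c d → OnlySeparator side e c d → Joins tree e c d →
      side e x ≡ side e c → Walk tree x y
    across c d (c≢d , same) j xc =
      walkWithin es x c (λ f ne →
        let f≢e = λ { refl → ne xc } in
        Any.tail f≢e (bound f λ xy → noncrossing e f xc yd e-sep xy (same f f≢e) ne))
      ++ʷ step e j (walkWithin es d y (λ f ne →
        let f≢e = λ { refl → ne (sym yd) } in
        Any.tail f≢e (bound f λ xy → noncrossing e f xc yd e-sep xy (same f f≢e)
                 λ xc′ → ne (trans (sym (same f f≢e)) (trans (sym xc′) xy)))))
      where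
      yd : side e y ≡ side e d
      yd = ≢-≢⇒≡ (≢-sym e-sep) (λ dx → c≢d (sym (trans dx xc)))

    via : Dec (side e x ≡ side e (a e)) → Walk tree x y
    via (yes xa) = across (a e) (b e) (only e) (inj₁ (refl , refl)) xa
    via (no x≢a) = across (b e) (a e) (OnlySeparator-sym side (only e)) (inj₂ (refl , refl))
                     (≢-≢⇒≡ x≢a (≢-sym (proj₁ (only e))))

  isTree : IsTree tree
  isTree = (λ x y → walkWithin (allFin r) x y (λ e _ → ∈-allFin e)) , acyclic

-- Submodularity of the order.

bit : Bool → ℕ
bit true  = 1
bit false = 0

∣∷∣ : ∀ {n} b (A : Subset n) → ∣ b ∷ A ∣ ≡ bit b + ∣ A ∣
∣∷∣ true  A = refl
∣∷∣ false A = refl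

bit-submodular : ∀ a b c d →
  bit ((a ∨ c) ∧ (b ∧ d)) + bit ((a ∧ c) ∧ (b ∨ d)) ≤ bit (a ∧ b) + bit (c ∧ d)
bit-submodular true  true  true  true  = ℕ.≤-refl
bit-submodular true  true  true  false = ℕ.≤-refl
bit-submodular true  true  false true  = ℕ.≤-refl
bit-submodular true  true  false false = z≤n
bit-submodular true  false true  true  = ℕ.≤-refl
bit-submodular true  false true  false = z≤n
bit-submodular true  false false d     = z≤n
bit-submodular false true  true  true  = ℕ.≤-refl
bit-submodular false true  true  false = z≤n
bit-submodular false true  false d     = z≤n
bit-submodular false false true  d     = z≤n
bit-submodular false false false d     = z≤n

-- The inequality holds vertex by vertex. The sets on the left become the separators of the join and
-- the meet.
∣∣-submodular : ∀ {n} (A B C D : Subset n) →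
  ∣ (A ∪ C) ∩ (B ∩ D) ∣ + ∣ (A ∩ C) ∩ (B ∪ D) ∣ ≤ ∣ A ∩ B ∣ + ∣ C ∩ D ∣
∣∣-submodular [] [] [] [] = z≤n
∣∣-submodular (a ∷ A) (b ∷ B) (c ∷ C) (d ∷ D) = begin
  ∣ i ∷ I ∣ + ∣ j ∷ J ∣                   ≡⟨ cong₂ _+_ (∣∷∣ i I) (∣∷∣ j J) ⟩
  (bit i + ∣ I ∣) + (bit j + ∣ J ∣)         ≡⟨ interchange (bit i) (∣ I ∣) (bit j) (∣ J ∣) ⟩
  (bit i + bit j) + (∣ I ∣ + ∣ J ∣)         ≤⟨ ℕ.+-mono-≤ (bit-submodular a b c d) (∣∣-submodular A B C D) ⟩
  (bit (a ∧ b) + bit (c ∧ d)) + (∣ A ∩ B ∣ + ∣ C ∩ D ∣)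
    ≡⟨ interchange (bit (a ∧ b)) (bit (c ∧ d)) (∣ A ∩ B ∣) (∣ C ∩ D ∣) ⟩
  (bit (a ∧ b) + ∣ A ∩ B ∣) + (bit (c ∧ d) + ∣ C ∩ D ∣)
    ≡⟨ cong₂ _+_ (∣∷∣ (a ∧ b) (A ∩ B)) (∣∷∣ (c ∧ d) (C ∩ D)) ⟨
  ∣ (a ∧ b) ∷ (A ∩ B) ∣ + ∣ (c ∧ d) ∷ (C ∩ D) ∣ ∎
  where
  open ℕ.≤-Reasoning
  i = (a ∨ c) ∧ (b ∧ d)
  I = (A ∪ C) ∩ (B ∩ D)
  j = (a ∧ c) ∧ (b ∨ d)
  J = (A ∩ C) ∩ (B ∪ D)

-- Directed separations and their corners.

module Separations (G : Digraph) where

  -- Empty edge sets are compatible with all vertex sets, so searching for a separation becomes a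
  -- search over pairs of subsets.
  edgeless : Subset (n G) → Subset (n G) → Pair G
  edgeless A B = sub A ⊥ ,ˢ sub B ⊥

  bare : Pair G → Pair G
  bare (A ,ˢ B) = edgeless (V A) (V B)

  join meet : Pair G → Pair G → Pair G
  join (A ,ˢ B) (C ,ˢ D) = edgeless (V A ∪ V C) (V B ∩ V D)
  meet (A ,ˢ B) (C ,ˢ D) = edgeless (V A ∩ V C) (V B ∪ V D)

  order-swap : (s : Pair G) → order (swap s) ≡ order s
  order-swap (A ,ˢ B) = cong ∣_∣ (∩-comm (V B) (V A))

  order-join-meet : (s c : Pair G) → order (join s c) + order (meet s c) ≤ order s + order c
  order-join-meet (A ,ˢ B) (C ,ˢ D) = ∣∣-submodular (V A) (V B) (V C) (V D)

  IsSep-swap : (s : Pair G) → IsSep G s → IsSep G (swap s)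
  IsSep-swap s (sA , sB , cover , dir) = sB , sA , Sum.swap ∘ cover , Sum.swap dir

  edgeless-sub : (A : Subset (n G)) → IsSubgraph G (sub A ⊥)
  edgeless-sub A e e∈ = contradiction e∈ ∉⊥

  IsSep-bare : (s : Pair G) → IsSep G s → IsSep G (bare s)
  IsSep-bare (A ,ˢ B) (_ , _ , cover , dir) = edgeless-sub (V A) , edgeless-sub (V B) , cover , dir

  noEdge? : (A B : SubgraphData G) → Dec (NoEdgeFromTo G A B)
  noEdge? A B = Fin.all? λ e →
    (tail G e ∈? V A) →-dec ¬? (tail G e ∈? V B) →-dec
    (head G e ∈? V B) →-dec ¬? (¬? (head G e ∈? V A))

  isSep-edgeless? : ∀ A B → Dec (IsSep G (edgeless A B))
  isSep-edgeless? A B = map′ (λ (cover , dir) → edgeless-sub A , edgeless-sub B , cover , dir)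
    (λ (_ , _ , cover , dir) → cover , dir)
    (Fin.all? (λ v → (v ∈? A) ⊎-dec (v ∈? B)) ×-dec
     (noEdge? (sub A ⊥) (sub B ⊥) ⊎-dec noEdge? (sub B ⊥) (sub A ⊥)))

  Parallel : Pair G → Pair G → Set
  Parallel (A ,ˢ B) (C ,ˢ D) =
    (NoEdgeFromTo G A B × NoEdgeFromTo G C D) ⊎ (NoEdgeFromTo G B A × NoEdgeFromTo G D C)

  parallel : ∀ s c → IsSep G s → IsSep G c → Parallel s c ⊎ Parallel (swap s) c
  parallel s c (_ , _ , _ , inj₁ x) (_ , _ , _ , inj₁ y) = inj₁ (inj₁ (x , y))
  parallel s c (_ , _ , _ , inj₁ x) (_ , _ , _ , inj₂ y) = inj₂ (inj₂ (x , y))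
  parallel s c (_ , _ , _ , inj₂ x) (_ , _ , _ , inj₁ y) = inj₂ (inj₁ (x , y))
  parallel s c (_ , _ , _ , inj₂ x) (_ , _ , _ , inj₂ y) = inj₁ (inj₂ (x , y))

  Parallel-swap : ∀ s c → Parallel s c → Parallel (swap s) (swap c)
  Parallel-swap s c = Sum.swap

  -- An edge in the forbidden direction has one end outside `V B ∩ V D`, hence outside `V B` or
  -- `V D`, and is already forbidden for `s` or `c`. Meets are covered as well: up to a swap they
  -- are joins of the swaps.
  IsSep-join : ∀ s c → IsSep G s → IsSep G c → Parallel s c → IsSep G (join s c)
  IsSep-join (A ,ˢ B) (C ,ˢ D) (_ , _ , AB , _) (_ , _ , CD , _) par =
    edgeless-sub _ , edgeless-sub _ , cover , direction par
    where
    ∉∪⁻ : ∀ {v} (P Q : Subset (n G)) → v ∉ P ∪ Q → v ∉ P × v ∉ Q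
    ∉∪⁻ P Q v∉ = v∉ ∘ x∈p∪q⁺ ∘ inj₁ , v∉ ∘ x∈p∪q⁺ ∘ inj₂

    left : ∀ {v} → v ∉ V B → v ∈ V A
    left v∉B = [ id , flip contradiction v∉B ]′ (AB _)

    left′ : ∀ {v} → v ∉ V D → v ∈ V C
    left′ v∉D = [ id , flip contradiction v∉D ]′ (CD _)

    ∉∩⁻ : ∀ {v} → v ∉ V B ∩ V D → v ∉ V B ⊎ v ∉ V D
    ∉∩⁻ {v} v∉ with v ∈? V B
    ... | no  v∉B = inj₁ v∉B
    ... | yes v∈B = inj₂ λ v∈D → v∉ (x∈p∩q⁺ (v∈B , v∈D))

    cover : ∀ v → v ∈ V A ∪ V C ⊎ v ∈ V B ∩ V D
    cover v with v ∈? (V B ∩ V D)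
    ... | yes v∈ = inj₂ v∈
    ... | no  v∉ = inj₁ (x∈p∪q⁺ (Sum.map left left′ (∉∩⁻ v∉)))

    J K : SubgraphData G
    J = sub (V A ∪ V C) ⊥
    K = sub (V B ∩ V D) ⊥

    direction : Parallel (A ,ˢ B) (C ,ˢ D) → NoEdgeFromTo G J K ⊎ NoEdgeFromTo G K J
    direction (inj₁ (noAB , noCD)) = inj₁ λ e _ t∉K h∈K h∉J →
      let h∈B , h∈D = x∈p∩q⁻ _ _ h∈K
          h∉A , h∉C = ∉∪⁻ _ _ h∉J
      in [ (λ t∉B → noAB e (left t∉B) t∉B h∈B h∉A)
         , (λ t∉D → noCD e (left′ t∉D) t∉D h∈D h∉C) ]′ (∉∩⁻ t∉K)
    direction (inj₂ (noBA , noDC)) = inj₂ λ e t∈K t∉J _ h∉K →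
      let t∈B , t∈D = x∈p∩q⁻ _ _ t∈K
          t∉A , t∉C = ∉∪⁻ _ _ t∉J
      in [ (λ h∉B → noBA e t∈B t∉A (left h∉B) h∉B)
         , (λ h∉D → noDC e t∈D t∉C (left′ h∉D) h∉D) ]′ (∉∩⁻ h∉K)

-- Properties of a single tangle.

module Tangle {G : Digraph} {T : SepSet G} (tangle : IsTangleOfSomeOrder G T) where
  open Separations G

  k : ℕ
  k = proj₁ tangle

  isSep : ∀ {s} → T s → IsSep G s
  isSep s∈ = proj₁ (proj₁ (proj₂ tangle) _ s∈)

  order< : ∀ {s} → T s → order s < k
  order< s∈ = proj₂ (proj₁ (proj₂ tangle) _ s∈)

  order-swap< : ∀ s → T (swap s) → order s < k
  order-swap< s s∈ = subst (_< k) (order-swap s) (order< s∈)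

  orient : ∀ s → IsSep G s → order s < k → T s ⊎ T (swap s)
  orient = proj₁ (proj₂ (proj₂ tangle))

  noCover : ∀ {s₁ s₂ s₃} → T s₁ → T s₂ → T s₃ →
    ¬ (∀ v → v ∈ V (fst s₁) ⊎ v ∈ V (fst s₂) ⊎ v ∈ V (fst s₃))
  noCover = proj₂ (proj₂ (proj₂ tangle)) _ _ _

  noCover₂ : ∀ {s₁ s₂} → T s₁ → T s₂ → ¬ (∀ v → v ∈ V (fst s₁) ⊎ v ∈ V (fst s₂))
  noCover₂ s₁∈ s₂∈ cover = noCover s₁∈ s₂∈ s₂∈ (Sum.map₂ inj₁ ∘ cover)

  exclusive : ∀ {s} → T s → ¬ T (swap s)
  exclusive s∈ s̅∈ = noCover₂ s∈ s̅∈ (proj₁ (proj₂ (proj₂ (isSep s∈))))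

  -- `T` is an arbitrary predicate; its decidability on separations comes from the orientation axiom
  -- together with `exclusive`.
  member? : ∀ s → IsSep G s → Dec (T s)
  member? s s-sep with order s <? k
  ... | no  s≮k = no (s≮k ∘ order<)
  ... | yes s<k with orient s s-sep s<k
  ...   | inj₁ s∈ = yes s∈
  ...   | inj₂ s̅∈ = no (flip exclusive s̅∈)

  member-edgeless? : ∀ A B → Dec (T (edgeless A B))
  member-edgeless? A B with isSep-edgeless? A B
  ... | yes sep = member? _ sep
  ... | no ¬sep = no (¬sep ∘ isSep)

  member-bare : ∀ {s} → T s → T (bare s)
  member-bare {s} s∈ with orient (bare s) (IsSep-bare s (isSep s∈)) (order< s∈)
  ... | inj₁ b∈ = b∈
  ... | inj₂ b̅∈ = contradiction (proj₁ (proj₂ (proj₂ (isSep s∈)))) (noCover₂ s∈ b̅∈)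

  -- The first sides of `s`, `c` and the swapped join cover the graph. This is where three different
  -- members enter the covering axiom.
  join∈ : ∀ {s c} → IsSep G (join s c) → order (join s c) < k → T s → T c → T (join s c)
  join∈ {s} {c} sep <k s∈ c∈ with orient (join s c) sep <k
  ... | inj₁ j∈ = j∈
  ... | inj₂ j̅∈ = contradiction (λ v → rearrange (proj₁ (proj₂ (proj₂ sep)) v)) (noCover s∈ c∈ j̅∈)
    where
    rearrange : ∀ {v} → v ∈ V (fst s) ∪ V (fst c) ⊎ v ∈ V (snd s) ∩ V (snd c) →
      v ∈ V (fst s) ⊎ v ∈ V (fst c) ⊎ v ∈ V (snd s) ∩ V (snd c)
    rearrange = Sum.assocʳ ∘ Sum.map₁ (x∈p∪q⁻ _ _)

  join∉ : ∀ s c → T (swap s) ⊎ T (swap c) → ¬ T (join s c)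
  join∉ s c (inj₁ s̅∈) j∈ = noCover₂ s̅∈ j∈ λ v →
    [ inj₂ ∘ x∈p∪q⁺ ∘ inj₁ , inj₁ ]′ (proj₁ (proj₂ (proj₂ (IsSep-swap _ (isSep s̅∈)))) v)
  join∉ s c (inj₂ c̅∈) j∈ = noCover₂ c̅∈ j∈ λ v →
    [ inj₂ ∘ x∈p∪q⁺ ∘ inj₂ , inj₁ ]′ (proj₁ (proj₂ (proj₂ (IsSep-swap _ (isSep c̅∈)))) v)

  join-swap∈ : ∀ s c → IsSep G (join s c) → order (join s c) < k →
    T (swap s) ⊎ T (swap c) → T (swap (join s c))
  join-swap∈ s c sep <k s̅c̅∈ = [ flip contradiction (join∉ s c s̅c̅∈) , id ]′ (orient _ sep <k)

-- Minimum order distinguishers and closeness.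

module Tangles (G : Digraph) {p : ℕ} (𝒯 : Fin p → SepSet G)
  (tangles : ∀ i → IsTangleOfSomeOrder G (𝒯 i))
  (distinguishable : ∀ i j → i ≢ j → Distinguishable (𝒯 i) (𝒯 j)) where

  open Separations G
  module 𝕋 (i : Fin p) = Tangle (tangles i)

  Divides : Pair G → Fin p → Fin p → Set
  Divides s i j = Distinguishes s (𝒯 i) (𝒯 j)

  MinDivides : Pair G → Fin p → Fin p → Set
  MinDivides s i j = MinOrderDistinguisher s (𝒯 i) (𝒯 j)

  divides-swap : ∀ {s i j} → Divides s i j → Divides (swap s) i j
  divides-swap = Sum.swap ∘ Sum.map Product.swap Product.swap

  divides-irrefl : ∀ {s i} → ¬ Divides s i i
  divides-irrefl {i = i} = [ uncurry (𝕋.exclusive i) , uncurry (𝕋.exclusive i) ]′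

  divides-order< : ∀ {s i j} → Divides s i j → order s < 𝕋.k j
  divides-order< {s} {i} {j} = [ 𝕋.order-swap< j s ∘ proj₂ , 𝕋.order< j ∘ proj₁ ]′

  divides-bare : ∀ {s i j} → Divides s i j → Divides (bare s) i j
  divides-bare {i = i} {j} = Sum.map
    (Product.map (𝕋.member-bare i) (𝕋.member-bare j))
    (Product.map (𝕋.member-bare j) (𝕋.member-bare i))

  divides? : ∀ s → IsSep G s → ∀ i j → Dec (Divides s i j)
  divides? s sep i j =
    (𝕋.member? i s sep ×-dec 𝕋.member? j _ (IsSep-swap s sep)) ⊎-dec
    (𝕋.member? j s sep ×-dec 𝕋.member? i _ (IsSep-swap s sep))

  divides-edgeless? : ∀ A B i j → Dec (Divides (edgeless A B) i j)
  divides-edgeless? A B i j =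
    (𝕋.member-edgeless? i A B ×-dec 𝕋.member-edgeless? j B A) ⊎-dec
    (𝕋.member-edgeless? j A B ×-dec 𝕋.member-edgeless? i B A)

  -- Descent on the order, bounded by `m`. Searching edgeless pairs loses nothing, as `bare` keeps
  -- the order and the distinguished pairs.
  minimum-below : ∀ {i j} m s → Divides s i j → order s ≤ m → ∃ λ s′ → MinDivides s′ i j
  minimum-below {i} {j} m s div s≤m
    with anySubset? (λ A → anySubset? (λ B → divides-edgeless? A B i j ×-dec (∣ A ∩ B ∣ <? order s)))
  ... | no none = s , div , λ s′ div′ →
          ℕ.≮⇒≥ λ s′<s → none (V (fst s′) , V (snd s′) , divides-bare div′ , s′<s)
  ... | yes (A , B , div′ , lt) with m
  ...   | zero   = contradiction (ℕ.<-≤-trans lt s≤m) λ ()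
  ...   | suc m′ = minimum-below m′ (edgeless A B) div′ (s≤s⁻¹ (ℕ.<-≤-trans lt s≤m))

  minimum : ∀ i j → i ≢ j → ∃ λ s → MinDivides s i j
  minimum i j i≢j with s , div ← distinguishable i j i≢j = minimum-below (order s) s div ℕ.≤-refl

  Close : ℕ → Fin p → Fin p → Set
  Close l i j = ∀ s → Divides s i j → l ≤ order s

  close-refl : ∀ {l i} → Close l i i
  close-refl s div = ⊥-elim (divides-irrefl div)

  close-sym : ∀ {l i j} → Close l i j → Close l j i
  close-sym close s = close s ∘ Sum.swap

  close-≤ : ∀ {l m i j} → l ≤ m → Close m i j → Close l i j
  close-≤ l≤m close s div = ℕ.≤-trans l≤m (close s div)

  close? : ∀ l i j → Dec (Close l i j)
  close? l i j with i Fin.≟ j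
  ... | yes refl = yes close-refl
  ... | no  i≢j with s , div , least ← minimum i j i≢j =
    map′ (λ l≤s s′ div′ → ℕ.≤-trans l≤s (least s′ div′)) (λ close → close s div) (l ≤? order s)

  -- A distinguisher of the two tangles has order at least `l` and is oriented by `j`. Hence
  -- distinct close tangles orient even the separations of order exactly `l`.
  close⇒order : ∀ {l i j} → i ≢ j → Close l i j → l < 𝕋.k j
  close⇒order i≢j close with s , div ← distinguishable _ _ i≢j =
    ℕ.≤-<-trans (close s div) (divides-order< div)

  close⇒agree : ∀ {l i j s} → Close l i j → order s < l → 𝒯 i s → 𝒯 j s
  close⇒agree {l} {i} {j} {s} close s<l s∈ with i Fin.≟ j
  ... | yes refl = s∈
  ... | no  i≢j with 𝕋.orient j s (𝕋.isSep i s∈) (ℕ.<-trans s<l (close⇒order i≢j close))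
  ...   | inj₁ s∈′ = s∈′
  ...   | inj₂ s̅∈ = contradiction (close s (inj₁ (s∈ , s̅∈))) (ℕ.<⇒≱ s<l)

  -- Below order `l` the tangles `i` and `j` agree, so a distinguisher of `i` and `h` of such an
  -- order would also distinguish `j` from `h`.
  close-trans : ∀ {l i j h} → Close l i j → Close l j h → Close l i h
  close-trans {l} ij jh s div = ℕ.≮⇒≥ λ s<l → ℕ.<⇒≱ s<l (jh s
    (Sum.map (Product.map₁ (close⇒agree ij s<l))
             (Product.map₂ (close⇒agree ij (subst (_< l) (sym (order-swap s)) s<l))) div))

  -- Families of noncrossing bipartitions.

  -- The bipartition side e extends the one by γ e beyond the tangles that γ e orients; faithful
  -- says that the two agree wherever γ e can be a minimum order distinguisher.
  record Family (k r : ℕ) : Set where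
    field
      side : Fin r → Fin p → Bool
      γ    : Fin r → Pair G
      isSep       : ∀ e → IsSep G (γ e)
      order≤      : ∀ e → order (γ e) ≤ k
      noncrossing : ∀ e f → NonCrossing (side e) (side f)
      ends        : ∀ e → ∃₂ λ i j → OnlySeparator side e i j
      faithful    : ∀ e {i j} → Close (order (γ e)) i j → side e i ≢ side e j → Divides (γ e) i j
      minimal     : ∀ e {i j} → side e i ≢ side e j →
                    ∃ λ f → side f i ≢ side f j × MinDivides (γ f) i j
      -- All orders below `k` are finished, while at order `k` pairs may still be waiting.
      unseparated : ∀ {i j} → (∀ e → side e i ≡ side e j) → Close k i j

  Separated : ∀ {k r} → Family k r → Fin p → Fin p → Set
  Separated F i j = ∃ λ e → Family.side F e i ≢ Family.side F e j

  separated? : ∀ {k r} (F : Family k r) i j → Dec (Separated F i j)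
  separated? F i j = Fin.any? λ e → ¬? (Family.side F e i ≟ Family.side F e j)

  unseparated⇒same : ∀ {k r} (F : Family k r) {i j} → ¬ Separated F i j →
    ∀ e → Family.side F e i ≡ Family.side F e j
  unseparated⇒same F ¬sep e = decidable-stable (_ ≟ _) λ ne → ¬sep (e , ne)

  -- Uncrossing a new separation from the family.

  module Extend {k r} (F : Family k r) {x y : Fin p} (x≢y : x ≢ y)
    (same : ∀ e → Family.side F e x ≡ Family.side F e y) where
    open Family F

    xy-close : Close k x y
    xy-close = unseparated same

    k<order : ∀ {w} → Close k x w → k < 𝕋.k w
    k<order {w} xw with x Fin.≟ w
    ... | no x≢w = close⇒order x≢w xw
    -- For `x` itself, `y` serves as the distinct close tangle.
    ... | yes refl = close⇒order (≢-sym x≢y) (close-sym xy-close)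

    orient : ∀ {w s} → Close k x w → IsSep G s → order s ≤ k → 𝒯 w s ⊎ 𝒯 w (swap s)
    orient {w} xw sep s≤k = 𝕋.orient w _ sep (ℕ.≤-<-trans s≤k (k<order xw))

    Splits : Pair G → Set
    Splits s = IsSep G s × order s ≤ k × Divides s x y

    -- If `s` splits `x` from `y`, both corners on their side of `f` are inhabited. Noncrossing on
    -- the close tangles then amounts to leaving the far side of `f` whole.
    Respects : Pair G → Fin r → Set
    Respects s f = ∀ {u v} → Close k x u → Close k x v →
      side f u ≢ side f x → side f v ≢ side f x → ¬ Divides s u v

    -- Used with `c` an orientation of `γ f`; `w` and `z` witness that `s` does not respect `f`. The
    -- join with `c` divides near tangles as `s` does and puts all far ones on one side.
    module Uncross {s c : Pair G} (f : Fin r) (splits : Splits s)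
      (c-sep : IsSep G c) (c-order : order c ≤ k)
      (near : ∀ {u} → Close k x u → side f u ≡ side f x → 𝒯 u c)
      (far : ∀ {u} → Close k x u → side f u ≢ side f x → 𝒯 u (swap c))
      (par : Parallel s c)
      {w z : Fin p} (xw : Close k x w) (xz : Close k x z)
      (w-far : side f w ≢ side f x) (z-far : side f z ≢ side f x)
      (s-wz : Divides s w z) where

      s-sep : IsSep G s
      s-sep = proj₁ splits

      -- m̅ is the meet of s and c, swapped. It distinguishes w from z, so its order is at least k,
      -- and submodularity bounds the order of j.
      j m̅ : Pair G
      j = join s c
      m̅ = join (swap s) (swap c)

      j-sep : IsSep G j
      j-sep = IsSep-join s c s-sep c-sep par

      m̅-sep : IsSep G m̅
      m̅-sep = IsSep-join _ _ (IsSep-swap s s-sep) (IsSep-swap c c-sep) (Parallel-swap s c par)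

      m̅-divides : order m̅ < k → Divides m̅ w z
      m̅-divides m̅<k = Sum.swap (Sum.map (λ (s∈ , s̅∈) → one xz xw z-far s∈ s̅∈)
                                        (λ (s∈ , s̅∈) → one xw xz w-far s∈ s̅∈) s-wz)
        where
        one : ∀ {u v} → Close k x u → Close k x v → side f u ≢ side f x →
          𝒯 v s → 𝒯 u (swap s) → 𝒯 u m̅ × 𝒯 v (swap m̅)
        one {u} {v} xu xv u-far s∈ s̅∈ =
          𝕋.join∈ u m̅-sep (ℕ.<-trans m̅<k (k<order xu)) s̅∈ (far xu u-far) ,
          𝕋.join-swap∈ v (swap s) (swap c) m̅-sep (ℕ.<-trans m̅<k (k<order xv)) (inj₁ s∈)

      m̅-order : k ≤ order m̅
      m̅-order = ℕ.≮⇒≥ λ m̅<k →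
        ℕ.<⇒≱ m̅<k (close-trans (close-sym xw) xz m̅ (m̅-divides m̅<k))

      j-order : order j ≤ k
      j-order = ℕ.+-cancelʳ-≤ k (order j) k (begin
        order j + k               ≤⟨ ℕ.+-monoʳ-≤ (order j) m̅-order ⟩
        order j + order m̅        ≡⟨ cong (order j +_) (order-swap (meet s c)) ⟩
        order j + order (meet s c) ≤⟨ order-join-meet s c ⟩
        order s + order c         ≤⟨ ℕ.+-mono-≤ (proj₁ (proj₂ splits)) c-order ⟩
        k + k                     ∎)
        where open ℕ.≤-Reasoning

      j<order : ∀ {u} → Close k x u → order j < 𝕋.k u
      j<order xu = ℕ.≤-<-trans j-order (k<order xu)

      near-join : ∀ {u v} → Close k x u → Close k x v → side f u ≡ side f x → side f v ≡ side f x →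
        Divides s u v → Divides j u v
      near-join xu xv u-near v-near = Sum.map
        (λ (s∈ , s̅∈) → one xu xv u-near s∈ s̅∈) (λ (s∈ , s̅∈) → one xv xu v-near s∈ s̅∈)
        where
        one : ∀ {u v} → Close k x u → Close k x v → side f u ≡ side f x →
          𝒯 u s → 𝒯 v (swap s) → 𝒯 u j × 𝒯 v (swap j)
        one {u} {v} xu xv u-near s∈ s̅∈ =
          𝕋.join∈ u j-sep (j<order xu) s∈ (near xu u-near) ,
          𝕋.join-swap∈ v s c j-sep (j<order xv) (inj₁ s̅∈)

      near-join⁻ : ∀ {u v} → Close k x u → Close k x v → side f u ≡ side f x → side f v ≡ side f x →
        Divides j u v → Divides s u v
      near-join⁻ xu xv u-near v-near = Sum.map
        (λ (j∈ , j̅∈) → one xu xv v-near j∈ j̅∈) (λ (j∈ , j̅∈) → one xv xu u-near j∈ j̅∈)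
        where
        one : ∀ {u v} → Close k x u → Close k x v → side f v ≡ side f x →
          𝒯 u j → 𝒯 v (swap j) → 𝒯 u s × 𝒯 v (swap s)
        one {u} {v} xu xv v-near j∈ j̅∈ with orient xu s-sep (proj₁ (proj₂ splits))
                                          | orient xv s-sep (proj₁ (proj₂ splits))
        ... | inj₂ s̅∈ | _       = contradiction j∈ (𝕋.join∉ u s c (inj₁ s̅∈))
        ... | inj₁ s∈ | inj₂ s̅∈ = s∈ , s̅∈
        ... | inj₁ _  | inj₁ s∈ = contradiction j̅∈
          (𝕋.exclusive v (𝕋.join∈ v j-sep (j<order xv) s∈ (near xv v-near)))

      j-splits : Splits j
      j-splits = j-sep , j-order , near-join close-refl xy-close refl (sym (same f)) (proj₂ (proj₂ splits))

      j-respects : Respects j f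
      j-respects {u} {v} xu xv u-far v-far =
        [ 𝕋.join∉ u s c (inj₂ (far xu u-far)) ∘ proj₁ , 𝕋.join∉ v s c (inj₂ (far xv v-far)) ∘ proj₁ ]′

      -- The new case has one of `u`, `v` near and one far with respect to `f`. As `f` and `g` do
      -- not cross, everything beyond `f` is then beyond `g`; so `w` and `z` are, and `s` would not
      -- respect `g`.
      j-preserves : ∀ {g} → Respects s g → Respects j g
      j-preserves {g} resp {u} {v} xu xv u-far v-far j-uv
        with side f u ≟ side f x | side f v ≟ side f x
      ... | yes u-near | yes v-near = resp xu xv u-far v-far (near-join⁻ xu xv u-near v-near j-uv)
      ... | no  u≢     | no  v≢     = j-respects xu xv u≢ v≢ j-uv
      ... | yes u-near | no  v≢     = resp xw xz (inside w-far) (inside z-far) s-wz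
        where
        inside : ∀ {t} → side f t ≢ side f x → side g t ≢ side g x
        inside t-far t-near = noncrossing f g (sym u-near) (≢-≢⇒≡ t-far v≢) (≢-sym t-far)
                                (sym t-near) (≢-≢⇒≡ u-far v-far) (≢-sym u-far)
      ... | no  u≢     | yes v-near = resp xw xz (inside w-far) (inside z-far) s-wz
        where
        inside : ∀ {t} → side f t ≢ side f x → side g t ≢ side g x
        inside t-far t-near = noncrossing f g (sym v-near) (≢-≢⇒≡ t-far u≢) (≢-sym t-far)
                                (sym t-near) (≢-≢⇒≡ v-far u-far) (≢-sym v-far)

    Respecting : Pair G → Fin r → Set
    Respecting s f = ∃ λ s′ → Splits s′ × Respects s′ f × (∀ {g} → Respects s g → Respects s′ g)

    uncross : ∀ f s → Splits s → Respecting s f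
    uncross f s splits@(s-sep , s≤k , s-xy)
      with Fin.any? (λ u → Fin.any? (λ v → close? k x u ×-dec close? k x v ×-dec
             ¬? (side f u ≟ side f x) ×-dec ¬? (side f v ≟ side f x) ×-dec divides? s s-sep u v))
    ... | no none = s , splits , (λ xu xv u-far v-far d → none (_ , _ , xu , xv , u-far , v-far , d)) , id
    ... | yes (w , z , xw , xz , w-far , z-far , s-wz) = toward orientation
      where
      Toward : Pair G → Set
      Toward c = IsSep G c × order c ≤ k × (∀ {u} → Close k x u → side f u ≢ side f x → 𝒯 u (swap c))
                 × (∀ {u} → Close k x u → side f u ≡ side f x → 𝒯 u c)

      across : ∀ {u v} → Close k x u → Close k x v → side f u ≢ side f v → Divides (γ f) u v
      across xu xv = faithful f (close-≤ (order≤ f) (close-trans (close-sym xu) xv))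

      flip∈ : ∀ {c u v} → Divides c u v → 𝒯 u c → 𝒯 v (swap c)
      flip∈ (inj₁ (_ , c̅∈)) _ = c̅∈
      flip∈ {u = u} (inj₂ (_ , c̅∈)) c∈ = ⊥-elim (𝕋.exclusive u c∈ c̅∈)

      oriented : ∀ c → IsSep G c → order c ≤ k → 𝒯 x c →
        (∀ {u v} → Close k x u → Close k x v → side f u ≢ side f v → Divides c u v) → Toward c
      oriented c sep c≤k c∈ div = sep , c≤k , c-far ,
        -- `faithful` speaks only of tangles on different sides of `f`, so a near tangle is compared
        -- with the far `w` instead of `x`.
        λ xu u-near → flip∈ (divides-swap (div xw xu (λ wu → w-far (trans wu u-near)))) (c-far xw w-far)
        where
        c-far : ∀ {u} → Close k x u → side f u ≢ side f x → 𝒯 u (swap c)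
        c-far xu u-far = flip∈ (div close-refl xu (≢-sym u-far)) c∈

      orientation : ∃ Toward
      orientation with orient close-refl (isSep f) (order≤ f)
      ... | inj₁ c∈ = γ f , oriented (γ f) (isSep f) (order≤ f) c∈ across
      ... | inj₂ c̅∈ = swap (γ f) , oriented (swap (γ f)) (IsSep-swap _ (isSep f))
              (subst (_≤ k) (sym (order-swap (γ f))) (order≤ f)) c̅∈
              λ xu xv ne → divides-swap (across xu xv ne)

      toward : ∃ Toward → Respecting s f
      toward (c , c-sep , c≤k , c-far , c-near) with parallel s c s-sep c-sep
      ... | inj₁ par = _ , U.j-splits , U.j-respects , U.j-preserves
        where module U = Uncross f splits c-sep c≤k c-near c-far par xw xz w-far z-far s-wz
      -- Directions are matched by swapping `s`, because the orientation of `c` is already fixed by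
      -- `x`.
      ... | inj₂ par = _ , U.j-splits , U.j-respects ,
              λ resp → U.j-preserves λ xu xv u-far v-far → resp xu xv u-far v-far ∘ divides-swap
        where
        s̅-splits : Splits (swap s)
        s̅-splits = IsSep-swap s s-sep , subst (_≤ k) (sym (order-swap s)) s≤k , divides-swap s-xy
        module U = Uncross f s̅-splits c-sep c≤k c-near c-far par xw xz w-far z-far (divides-swap s-wz)

    -- Uncrossing from one member keeps the respect for the others, so one pass suffices. `ι` allows
    -- induction on the members treated while the family stays fixed.
    uncrossAll : ∀ {m} (ι : Fin m → Fin r) s → Splits s → ∃ λ s′ → Splits s′ × ∀ i → Respects s′ (ι i)
    uncrossAll {zero}  ι s splits = s , splits , λ ()
    uncrossAll {suc m} ι s splits
      with s₁ , splits₁ , resp₁ ← uncrossAll (ι ∘ suc) s splits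
      with s₂ , splits₂ , resp , keeps ← uncross (ι zero) s₁ splits₁
      = s₂ , splits₂ , λ { zero → resp ; (suc i) → keeps (resp₁ i) }

    -- Adding the uncrossed separation to the family.

    module Insert (s : Pair G) (splits : Splits s) (respects : ∀ f → Respects s f) where

      s-sep : IsSep G s
      s-sep = proj₁ splits

      s≤k : order s ≤ k
      s≤k = proj₁ (proj₂ splits)

      s-xy : Divides s x y
      s-xy = proj₂ (proj₂ splits)

      -- The bipartition by s of the tangles close to x, extended to the other tangles: those
      -- that some member of the family cuts off from x take the side of the close tangles
      -- that are cut off with them.
      Marked : Fin p → Set
      Marked z = (Close k x z × 𝒯 z s) ⊎
        ∃₂ λ f w → Close k x w × 𝒯 w s × side f w ≢ side f x × side f z ≢ side f x

      abstract
        marked? : ∀ z → Dec (Marked z)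
        marked? z = (close? k x z ×-dec 𝕋.member? z s s-sep) ⊎-dec
          Fin.any? λ f → Fin.any? λ w → close? k x w ×-dec 𝕋.member? w s s-sep ×-dec
            ¬? (side f w ≟ side f x) ×-dec ¬? (side f z ≟ side f x)

      σ : Fin p → Bool
      σ z = does (marked? z)

      σ-≡ : ∀ {u v} → (Marked u → Marked v) → (Marked v → Marked u) → σ u ≡ σ v
      σ-≡ to from = does-⇔ (mk⇔ to from) (marked? _) (marked? _)

      σ-≢ : ∀ {u v} → Marked u → ¬ Marked v → σ u ≢ σ v
      σ-≢ {u} {v} u∈ v∉ eq with () ←
        trans (sym (dec-true (marked? u) u∈)) (trans eq (dec-false (marked? v) v∉))

      σ-≢⁻ : ∀ {u v} → σ u ≢ σ v → (Marked u × ¬ Marked v) ⊎ (Marked v × ¬ Marked u)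
      σ-≢⁻ {u} {v} ne with marked? u | marked? v
      ... | yes u∈ | no  v∉ = inj₁ (u∈ , v∉)
      ... | no  u∉ | yes v∈ = inj₂ (v∈ , u∉)
      ... | yes _  | yes _  = contradiction refl ne
      ... | no  _  | no  _  = contradiction refl ne

      -- The extension is consistent on close tangles: respecting `f` forces `z` to orient `s` as
      -- `w` does.
      close-marked : ∀ {z} → Close k x z → Marked z → 𝒯 z s
      close-marked xz (inj₁ (_ , z∈)) = z∈
      close-marked xz (inj₂ (f , w , xw , w∈ , w-far , z-far)) with orient xz s-sep s≤k
      ... | inj₁ z∈ = z∈
      ... | inj₂ z̅∈ = contradiction (inj₁ (w∈ , z̅∈)) (respects f xw xz w-far z-far)

      close-unmarked : ∀ {z} → Close k x z → ¬ Marked z → 𝒯 z (swap s)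
      close-unmarked xz z∉ = [ (λ z∈ → contradiction (inj₁ (xz , z∈)) z∉) , id ]′ (orient xz s-sep s≤k)

      -- If the witness `w` is beyond `f`, it also marks `v` through `f`. Otherwise noncrossing puts
      -- the far side of `f` inside that of `g`, and `g` with `w` marks `v`.
      far-marked : ∀ f {u v} → side f u ≢ side f x → side f v ≢ side f x → Marked u → Marked v
      far-marked f {u} {v} u-far v-far (inj₁ (xu , u∈)) = inj₂ (f , u , xu , u∈ , u-far , v-far)
      far-marked f {u} {v} u-far v-far (inj₂ (g , w , xw , w∈ , w-far , u-far′)) with side f w ≟ side f x
      ... | no  w-far′ = inj₂ (f , w , xw , w∈ , w-far′ , v-far)
      ... | yes w-near = inj₂ (g , w , xw , w∈ , w-far , λ v-near →
        noncrossing f g (sym w-near) (≢-≢⇒≡ v-far u-far) (≢-sym v-far)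
                        (sym v-near) (≢-≢⇒≡ w-far u-far′) (≢-sym w-far))

      far-same : ∀ f {u v} → side f u ≢ side f x → side f v ≢ side f x → σ u ≡ σ v
      far-same f u-far v-far = σ-≡ (far-marked f u-far v-far) (far-marked f v-far u-far)

      -- One of the pairs `a`, `b` and `c`, `d` lies beyond `f` as seen from `x`, where `σ` is
      -- constant.
      σ-noncrossing : ∀ f → NonCrossing (side f) σ
      σ-noncrossing f {a} {b} {c} {d} ab cd a≢c ac bd a≢b with side f a ≟ side f x
      ... | no  a-far  = a≢b (far-same f a-far (a-far ∘ trans ab))
      ... | yes a-near = a≢b (trans ac (trans (far-same f c-far (c-far ∘ trans cd)) (sym bd)))
        where
        c-far : side f c ≢ side f x
        c-far c-near = a≢c (trans a-near (sym c-near))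

      σ-xy : σ x ≢ σ y
      σ-xy = [ (λ (x∈ , y̅∈) → σ-≢ (inj₁ (close-refl , x∈)) λ y∈ →
                 𝕋.exclusive y (close-marked xy-close y∈) y̅∈)
             , (λ (y∈ , x̅∈) → ≢-sym (σ-≢ (inj₁ (xy-close , y∈)) λ x∈ →
                 𝕋.exclusive x (close-marked close-refl x∈) x̅∈)) ]′ s-xy

      low-same : ∀ e {i j} → order (γ e) < k → Close k i j → side e i ≡ side e j
      low-same e low close = decidable-stable (_ ≟ _) λ ne →
        ℕ.<⇒≱ low (close (γ e) (faithful e (close-≤ (ℕ.<⇒≤ low) close) ne))

      low-separator : ∀ {i} → ¬ Close k x i → ∃ λ e → side e x ≢ side e i × order (γ e) < k
      low-separator {i} ¬xi with separated? F x i
      ... | no ¬sep = contradiction (unseparated (unseparated⇒same F ¬sep)) ¬xi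
      ... | yes (e₀ , ne₀) with e , ne , _ , least ← minimal e₀ ne₀ =
        e , ne , ℕ.≰⇒> λ k≤e → ¬xi λ s′ div → ℕ.≤-trans k≤e (least s′ div)

      -- If `i` is not close to `x`, a member `e` of order below `k` cuts `i` and `j` off from `x`
      -- and `w`. But `g` cuts `i` and `w` off from `j` and `x`, so `e` and `g` would cross.
      marked-divides : ∀ {i j} → Close k i j → Marked i → ¬ Marked j → 𝒯 i s × 𝒯 j (swap s)
      marked-divides {i} {j} ij i∈ j∉ with close? k x i
      ... | yes xi = close-marked xi i∈ , close-unmarked (close-trans xi ij) j∉
      marked-divides {i} {j} ij (inj₁ (xi , _)) j∉ | no ¬xi = contradiction xi ¬xi
      marked-divides {i} {j} ij (inj₂ (g , w , xw , w∈ , w-far , i-far)) j∉ | no ¬xi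
        with e , e-xi , low ← low-separator ¬xi =
        ⊥-elim (noncrossing e g
          (low-same e low ij) (sym wx) (λ iw → e-xi (sym (trans iw (sym wx))))
          (≢-≢⇒≡ i-far w-far) j-near (λ gij → i-far (trans gij j-near)))
        where
        wx : side e x ≡ side e w
        wx = low-same e low xw
        j-near : side g j ≡ side g x
        j-near = decidable-stable (_ ≟ _) λ j-far → j∉ (inj₂ (g , w , xw , w∈ , w-far , j-far))

      σ-faithful : ∀ {i j} → Close k i j → σ i ≢ σ j → Divides s i j
      σ-faithful ij ne = Sum.map
        (λ (i∈ , j∉) → marked-divides ij i∈ j∉)
        (λ (j∈ , i∉) → marked-divides (close-sym ij) j∈ i∉) (σ-≢⁻ ne)

      side⁺ : Fin (suc r) → Fin p → Bool
      side⁺ zero    = σ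
      side⁺ (suc e) = side e

      γ⁺ : Fin (suc r) → Pair G
      γ⁺ zero    = s
      γ⁺ (suc e) = γ e

      -- `x` and `y` represent the two halves into which `σ` splits their common node.
      pick : ∀ t → ∃ λ z → σ z ≡ σ t × (∀ f → side f z ≡ side f x)
      pick t with σ x ≟ σ t
      ... | yes xt  = x , xt , λ _ → refl
      ... | no  x≢t = y , ≢-≢⇒≡ (≢-sym σ-xy) (≢-sym x≢t) , sym ∘ same

      -- If σ separates the ends a, b of e, it splits the node of x and y, which is then the
      -- node of b; the half that takes the place of b is the one on the side of a.
      reattach : ∀ e a b → OnlySeparator side e a b → σ a ≢ σ b → side e b ≡ side e x →
        ∃ λ z → OnlySeparator side⁺ (suc e) a z
      reattach e a b (e-ab , only) σ-ab b-near
        with z , σz , z-near ← pick a with z′ , σz′ , z′-near ← pick b =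
        z , (λ az → e-ab (trans az (trans (z-near e) (sym b-near)))) , only⁺
        where
        only⁺ : ∀ f → f ≢ suc e → side⁺ f a ≡ side⁺ f z
        only⁺ zero    _  = sym σz
        -- `z` and `z′` lie on the same side of `f` in different halves of `σ`; if `f` separated `a`
        -- from `z`, then `a` and `b` would fill the other two corners.
        only⁺ (suc f) ne = decidable-stable (_ ≟ _) λ az → σ-noncrossing f
          (trans (z-near f) (sym (z′-near f))) (only f (ne ∘ cong suc)) (≢-sym az)
          σz σz′ λ zz′ → σ-ab (trans (sym σz) (trans zz′ σz′))

      transfer : ∀ e a b → OnlySeparator side e a b → ∃₂ λ i j → OnlySeparator side⁺ (suc e) i j
      transfer e a b only with σ a ≟ σ b | side e b ≟ side e x
      ... | yes σ-ab | _ =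
        a , b , proj₁ only , λ { zero _ → σ-ab ; (suc f) ne → proj₂ only f (ne ∘ cong suc) }
      ... | no σ-ab | yes b-near = a , reattach e a b only σ-ab b-near
      ... | no σ-ab | no  b-far  = b , reattach e b a (OnlySeparator-sym side only) (≢-sym σ-ab)
                                         (≢-≢⇒≡ (proj₁ only) (≢-sym b-far))

      ends⁺ : ∀ e → ∃₂ λ i j → OnlySeparator side⁺ e i j
      ends⁺ zero    = x , y , σ-xy , λ { zero ne → contradiction refl ne ; (suc f) _ → same f }
      ends⁺ (suc e) with a , b , only ← ends e = transfer e a b only

      minimal⁺ : ∀ e {i j} → side⁺ e i ≢ side⁺ e j →
        ∃ λ f → side⁺ f i ≢ side⁺ f j × MinDivides (γ⁺ f) i j
      minimal⁺ e {i} {j} ne with separated? F i j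
      ... | yes (e₀ , ne₀) with f , rest ← minimal e₀ ne₀ = suc f , rest
      minimal⁺ (suc e) ne | no ¬sep = contradiction (e , ne) ¬sep
      minimal⁺ zero {i} {j} ne | no ¬sep = zero , ne , σ-faithful ij ne , close-≤ s≤k ij
        where
        ij : Close k i j
        ij = unseparated (unseparated⇒same F ¬sep)

      family : Family k (suc r)
      family = record
        { side        = side⁺
        ; γ           = γ⁺
        ; isSep       = λ { zero → s-sep ; (suc e) → isSep e }
        ; order≤      = λ { zero → s≤k ; (suc e) → order≤ e }
        ; noncrossing = λ
            { zero zero       → NonCrossing-refl σ
            ; zero (suc f)    → NonCrossing-sym {σ = side f} {σ} (σ-noncrossing f)
            ; (suc e) zero    → σ-noncrossing e
            ; (suc e) (suc f) → noncrossing e f }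
        ; ends        = ends⁺
        -- No distinguisher of `x` and `y` has order below `k`, so closeness at the order of `s`
        -- implies closeness at `k`.
        ; faithful    = λ { zero → σ-faithful ∘ close-≤ (xy-close s s-xy) ; (suc e) → faithful e }
        ; minimal     = minimal⁺
        ; unseparated = λ same⁺ → unseparated (same⁺ ∘ suc)
        }

  -- Iteration over pairs and orders.

  Refines : ∀ {k r r′} → Family k r → Family k r′ → Set
  Refines F F′ = ∀ {i j} → Separated F i j → Separated F′ i j

  -- In the remaining case the minimum distinguisher has order exactly `k`: at most `k` by the
  -- failure of closeness, at least `k` because the pair is unseparated.
  separate : ∀ {k r} (F : Family k r) i j →
    ∃ λ r′ → Σ[ F′ ∈ Family k r′ ] Refines F F′ × (Separated F′ i j ⊎ Close (suc k) i j)
  separate {k} {r} F i j with separated? F i j | close? (suc k) i j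
  ... | yes sep | _      = r , F , id , inj₁ sep
  ... | no _    | yes ij = r , F , id , inj₂ ij
  ... | no ¬sep | no ¬ij
    with i≢j ← (λ { refl → ¬ij close-refl })
    with s , div , least ← minimum i j i≢j
    with s′ , splits , respects ← Extend.uncrossAll F i≢j (unseparated⇒same F ¬sep) id s
           ( [ 𝕋.isSep i ∘ proj₁ , 𝕋.isSep j ∘ proj₁ ]′ div
           , ℕ.≮⇒≥ (λ k<s → ¬ij λ s″ div″ → ℕ.≤-trans k<s (least s″ div″)) , div )
    = suc r , I.family , (λ (e , ne) → suc e , ne) , inj₁ (zero , I.σ-xy)
    where module I = Extend.Insert F i≢j (unseparated⇒same F ¬sep) s′ splits respects

  separateAll : ∀ {k r m} (ι : Fin m → Fin p × Fin p) (F : Family k r) →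
    ∃ λ r′ → Σ[ F′ ∈ Family k r′ ] Refines F F′ ×
      (∀ h → let i , j = ι h in Separated F′ i j ⊎ Close (suc k) i j)
  separateAll {m = zero}  ι F = _ , F , id , λ ()
  separateAll {m = suc m} ι F
    with r₁ , F₁ , ref₁ , done₁ ← separateAll (ι ∘ suc) F
    with r₂ , F₂ , ref₂ , done₂ ← separate F₁ (proj₁ (ι zero)) (proj₂ (ι zero))
    = r₂ , F₂ , (λ sep → ref₂ (ref₁ sep)) , λ { zero → done₂ ; (suc h) → Sum.map₁ ref₂ (done₁ h) }

  raise : ∀ {k r} (F : Family k r) → (∀ i j → Separated F i j ⊎ Close (suc k) i j) → Family (suc k) r
  raise F done = record
    { Family F
    ; order≤      = ℕ.m≤n⇒m≤1+n ∘ Family.order≤ F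
    ; unseparated = λ {i} {j} same → [ (λ (e , ne) → contradiction (same e) ne) , id ]′ (done i j)
    }

  families : ∀ k → ∃ (Family k)
  families zero = 0 , record
    { side = λ () ; γ = λ () ; isSep = λ () ; order≤ = λ () ; noncrossing = λ () ; ends = λ ()
    ; faithful = λ () ; minimal = λ () ; unseparated = λ _ _ _ → z≤n }
  -- `remQuot` enumerates all ordered pairs of tangles.
  families (suc k) with r , F ← families k with r′ , F′ , _ , done ← separateAll (remQuot {p} p) F =
    r′ , raise F′ λ i j → subst (λ (i , j) → Separated F′ i j ⊎ Close (suc k) i j)
                            (Fin.remQuot-combine i j) (done (combine i j))

  -- The tree-labelling.

  close⇒≡ : ∀ {i j} → Close (suc (n G)) i j → i ≡ j
  close⇒≡ close = decidable-stable (_ Fin.≟ _) λ i≢j →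
    let s , div = distinguishable _ _ i≢j
    -- A separator has at most `n G` vertices, so closeness at `suc (n G)` excludes every
    -- distinguisher.
    in ℕ.<⇒≱ (close s div) (∣p∣≤n (V (fst s) ∩ V (snd s)))

  treeLabelling : HasTreeLabelling G 𝒯
  treeLabelling with r , F ← families (suc (n G)) =
    tree , id , γ , isTree , isSep , ((λ eq → eq) , λ i → i , λ eq → eq) , onPaths , onEdges
    where
    open Family F
    open CutTree side (proj₁ ∘ ends) (proj₁ ∘ proj₂ ∘ ends) (proj₂ ∘ proj₂ ∘ ends)
      noncrossing (λ i j same → close⇒≡ (unseparated same))

    -- Some minimum distinguisher `γ f` belongs to a separator `f` of the ends, which lies on `P`.
    -- As `γ e` has no larger order, the ends are close at its order and `faithful` applies.
    onPaths : ∀ t t′ → t ≢ t′ → (P : Walk tree t t′) → IsPath P → ∀ e → e ∈ₗ edges P →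
      (∀ e′ → e′ ∈ₗ edges P → order (γ e) ≤ order (γ e′)) → MinDivides (γ e) t t′
    onPaths t t′ _ P path e e∈P least
      with e-sep ← path∋⇒sep P path e∈P
      with f , f-sep , _ , f-least ← minimal e e-sep = faithful e close e-sep , close
      where
      close : Close (order (γ e)) t t′
      close s div = ℕ.≤-trans (least f (sep⇒∈ P f-sep)) (f-least s div)

    -- The ends of `e` themselves serve: only `e` separates them, so the member given by `minimal`
    -- must be `e`.
    onEdges : ∀ e → Σ[ t ∈ Fin p ] Σ[ t′ ∈ Fin p ]
      InComponentWithout tree e (end₁ tree e) t × InComponentWithout tree e (end₂ tree e) t′ ×
      MinDivides (γ e) t t′
    onEdges e with minimal e (proj₁ (proj₂ (proj₂ (ends e))))
    ... | f , f-sep , f-min with f Fin.≟ e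
    ...   | yes refl = _ , _ , ([] , λ ()) , ([] , λ ()) , f-min
    ...   | no  f≢e  = contradiction (proj₂ (proj₂ (proj₂ (ends e))) f f≢e) f-sep

theorem6p2 : (G : Digraph) (p : ℕ) (𝒯 : Fin p → SepSet G) →
    (∀ i → IsTangleOfSomeOrder G (𝒯 i)) →
    (∀ i j → i ≢ j → Distinguishable (𝒯 i) (𝒯 j)) →
    HasTreeLabelling G 𝒯
theorem6p2 G p 𝒯 tangles distinguishable = Tangles.treeLabelling G 𝒯 tangles distinguishable
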